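{- Let $\iota\colon\mathbb R\to\mathcal R$ be the map from the space of Dedekind reals to the continuous dcpo $\mathcal R$ of partial Dedekind reals given by $\iota(L_x,U_x)=\{(p,q)\mid p\in L_x,\ q\in U_x\}$. The map $\iota$ is a homeomorphism from $\mathbb R$ to the space of strongly maximal elements of $\mathcal R$ with the relative Scott topology. Moreover, $\iota$ preserves and reflects apartness: for all $x,y\in\mathbb R$, $x\mathrel{\#_{\mathbb R}}y$ if and only if $\iota(x)\mathrel{\#_{\mathcal R}}\iota(y)$.
   Context: Everything is constructive: neither excluded middle nor choice is assumed. A subset $S$ of a poset is directed if it is inhabited and any two elements of $S$ have an upper bound in $S$. A dcpo is a poset $(D,\sqsubseteq)$ in which every directed subset $S$ has a supremum $\bigsqcup S$. Write $x\ll y$ if for every directed $S$ with $y\sqsubseteq\bigsqcup S$ there is $s\in S$ with $x\sqsubseteq s$. $D$ is continuous if for every $x$ the set $\{y\in D\mid y\ll x\}$ is directed with supremum $x$. A subset $U\subseteq D$ is Scott open if it is an upper set and whenever $\bigsqcup S\in U$ with $S$ directed, some $s\in S$ is in $U$. Two points of $D$ are Hausdorff separated if they have disjoint Scott open neighbourhoods. An element $x$ of a continuous dcpo $D$ is strongly maximal if for every $u,v\in D$ with $u\ll v$, we have $u\ll x$, or $v$ and $x$ are Hausdorff separated. A Dedekind real is a pair $x=(L_x,U_x)$ of subsets of $\mathbb Q$ (write $p<x$ for $p\in L_x$ and $x<q$ for $q\in U_x$) that is: bounded (there are $p,q\in\mathbb Q$ with $p<x$ and $x<q$); rounded ($p<x\iff\exists_{r\in\mathbb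 Q}(p<r\wedge r<x)$ and $x<q\iff\exists_{s\in\mathbb Q}(s<q\wedge x<s)$ for all $p,q\in\mathbb Q$); transitive ($p<x$ and $x<q$ imply $p<q$); located (for $p<q$ in $\mathbb Q$, $p<x$ or $x<q$). $\mathbb R$ is the space of Dedekind reals with basic opens $\{x\in\mathbb R\mid p<x\text{ and }x<q\}$ for $p,q\in\mathbb Q$, and apartness $x\mathrel{\#_{\mathbb R}}y\iff\exists_{p\in\mathbb Q}\,(x<p<y)\vee(y<p<x)$. Let $\mathbb Q\times_<\mathbb Q=\{(p,q)\in\mathbb Q\times\mathbb Q\mid p<q\}$ with $(p,q)\prec(r,s)\iff p<r<s<q$. $\mathcal R$ is the rounded ideal completion of $(\mathbb Q\times_<\mathbb Q,\prec)$: its elements (partial Dedekind reals) are the subsets $I$ that are lower with respect to $\prec$ and directed with respect to $\prec$ (inhabited, and any $a,b\in I$ have some $c\in I$ with $a\prec c$ and $b\prec c$), ordered by inclusion, with directed suprema given by unions. It is a continuous dcpo. The relation $\#_{\mathcal R}$ is the intrinsic apartness of $\mathcal R$: $I\mathrel{\#_{\mathcal R}}J$ if there is a Scott open set containing $I$ but not $J$, or one containing $J$ but not $I$. -}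

module Defs where

open import Level using (Level; 0ℓ; _⊔_) renaming (suc to lsuc)
open import Data.Product using (Σ; ∃; ∃₂; _×_; _,_; proj₁; proj₂; Σ-syntax; ∃-syntax)
open import Data.Sum using (_⊎_; inj₁; inj₂)
open import Data.Unit.Polymorphic using (⊤; tt)
open import Data.Rational as ℚ using (ℚ; _<_; 1ℚ)
import Data.Rational.Properties as ℚₚ
open import Function.Base using (_∘_; id)
open import Function.Bundles using (_⇔_; mk⇔; Equivalence)
open import Function.Structures using (IsInverse)
open import Relation.Binary.Bundles using (Setoid; Poset)
open import Relation.Binary.Core using (Rel)
open import Relation.Binary.Definitions using (Transitive)
open import Relation.Binary.PropositionalEquality using (subst; sym)
open import Relation.Nullary using (¬_)
open import Relation.Unary using (Pred; _∈_; _⊆_; _≐_; _∩_; ⋃)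

-- Propositions are types: a subset is a predicate, ∃ is Σ, "or" is _⊎_.
-- Subsets are compared by mutual inclusion, so carriers are setoids.

------------------------------------------------------------------------
-- Topological spaces

record TopologicalSpace (c ℓ o t : Level) : Set (lsuc (c ⊔ ℓ ⊔ o ⊔ t)) where
  field
    setoid : Setoid c ℓ
  open Setoid setoid public using (Carrier; _≈_)
  field
    Open      : Pred (Pred Carrier o) t
    open-resp : ∀ {U V} → U ≐ V → Open U → Open V
    open-cong : ∀ {U} → Open U → ∀ {x y} → x ≈ y → x ∈ U → y ∈ U
    open-⊤    : Open (λ _ → ⊤)
    open-∩    : ∀ {U V} → Open U → Open V → Open (U ∩ V)
    open-⋃    : ∀ {I : Set o} (V : I → Pred Carrier o) →
                (∀ j → Open (V j)) → Open (⋃ I V)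

module _ {c ℓ o t p : Level} (X : TopologicalSpace c ℓ o t) where
  open TopologicalSpace X

  Subspace : Pred Carrier p →
             TopologicalSpace (c ⊔ p) ℓ o (c ⊔ p ⊔ lsuc o ⊔ t)
  Subspace P = record
    { setoid = record
      { Carrier = Σ Carrier P
      ; _≈_ = λ x y → proj₁ x ≈ proj₁ y
      ; isEquivalence = record
        { refl = Setoid.refl setoid
        ; sym = Setoid.sym setoid
        ; trans = Setoid.trans setoid
        }
      }
    ; Open = λ V → ∃[ U ] Open U × V ≐ (U ∘ proj₁)
    ; open-resp = λ { (V⊆W , W⊆V) (U , oU , V⊆U , U⊆V) →
        U , oU , (λ w → V⊆U (W⊆V w)) , (λ u → V⊆W (U⊆V u)) }
    ; open-cong = λ { (U , oU , V⊆U , U⊆V) x≈y v →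
        U⊆V (open-cong oU x≈y (V⊆U v)) }
    ; open-⊤ = (λ _ → ⊤) , open-⊤ , id , id
    ; open-∩ = λ { (U , oU , V⊆U , U⊆V) (U′ , oU′ , V′⊆U′ , U′⊆V′) →
        U ∩ U′ , open-∩ oU oU′ ,
        (λ { (v , v′) → V⊆U v , V′⊆U′ v′ }) ,
        (λ { (u , u′) → U⊆V u , U′⊆V′ u′ }) }
    ; open-⋃ = λ {I} V oV →
        ⋃ I (λ j → proj₁ (oV j)) ,
        open-⋃ _ (λ j → proj₁ (proj₂ (oV j))) ,
        (λ { (j , v) → j , proj₁ (proj₂ (proj₂ (oV j))) v }) ,
        (λ { (j , u) → j , proj₂ (proj₂ (proj₂ (oV j))) u })
    }

module _ {c₁ ℓ₁ t₁ c₂ ℓ₂ t₂ o : Level}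
         (X : TopologicalSpace c₁ ℓ₁ o t₁) (Y : TopologicalSpace c₂ ℓ₂ o t₂) where
  private
    module X = TopologicalSpace X
    module Y = TopologicalSpace Y

  Continuous : (X.Carrier → Y.Carrier) → Set (c₂ ⊔ lsuc o ⊔ t₁ ⊔ t₂)
  Continuous f = ∀ V → Y.Open V → X.Open (V ∘ f)

module _ {c₁ ℓ₁ t₁ c₂ ℓ₂ t₂ o : Level}
         (X : TopologicalSpace c₁ ℓ₁ o t₁) (Y : TopologicalSpace c₂ ℓ₂ o t₂) where
  private
    module X = TopologicalSpace X
    module Y = TopologicalSpace Y

  record IsHomeomorphism (f : X.Carrier → Y.Carrier)
         : Set (c₁ ⊔ ℓ₁ ⊔ t₁ ⊔ c₂ ⊔ ℓ₂ ⊔ t₂ ⊔ lsuc o) where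
    field
      inverse            : Y.Carrier → X.Carrier
      isInverse          : IsInverse X._≈_ Y._≈_ f inverse
      continuous         : Continuous X Y f
      inverse-continuous : Continuous Y X inverse

------------------------------------------------------------------------
-- Dcpos

-- A directed subset is given as the image of a family f : I → Carrier.

module _ {c ℓ₁ ℓ₂ : Level} (P : Poset c ℓ₁ ℓ₂) where
  open Poset P

  record IsDirected {i : Level} {I : Set i} (f : I → Carrier) : Set (i ⊔ ℓ₂) where
    field
      inhabited  : I
      upperBound : ∀ j k → ∃[ l ] f j ≤ f l × f k ≤ f l

  record IsSupremum {i : Level} {I : Set i} (f : I → Carrier) (s : Carrier)
         : Set (i ⊔ c ⊔ ℓ₂) where
    field
      isUpperBound : ∀ j → f j ≤ s
      isLeast      : ∀ u → (∀ j → f j ≤ u) → s ≤ u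

-- Completeness is relative to a universe of index types: for lack of
-- propositional resizing, the union of a larger family of Set₀-valued
-- subsets need not be a Set₀-valued subset.

record DCPO (c ℓ₁ ℓ₂ i : Level) : Set (lsuc (c ⊔ ℓ₁ ⊔ ℓ₂ ⊔ i)) where
  field
    poset : Poset c ℓ₁ ℓ₂
  open Poset poset public using (Carrier; _≈_) renaming (_≤_ to _⊑_)
  field
    ⨆            : {I : Set i} (f : I → Carrier) → IsDirected poset f → Carrier
    ⨆-isSupremum : {I : Set i} (f : I → Carrier) (d : IsDirected poset f) →
                   IsSupremum poset f (⨆ f d)

  infix 4 _≪_
  _≪_ : Carrier → Carrier → Set (c ⊔ ℓ₂ ⊔ lsuc i)
  x ≪ y = {I : Set i} (f : I → Carrier) (d : IsDirected poset f) →
          y ⊑ ⨆ f d → ∃[ j ] x ⊑ f j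

  IsContinuous : Set (c ⊔ ℓ₂ ⊔ lsuc i)
  IsContinuous = ∀ x →
    IsDirected poset {I = ∃[ y ] y ≪ x} proj₁ ×
    IsSupremum poset {I = ∃[ y ] y ≪ x} proj₁ x

  -- Opens are valued in the universe of _≪_, so that { y | x ≪ y } is a
  -- candidate.

  record IsScottOpen (U : Pred Carrier (c ⊔ ℓ₂ ⊔ lsuc i)) : Set (c ⊔ ℓ₂ ⊔ lsuc i) where
    field
      upper        : ∀ {x y} → x ⊑ y → x ∈ U → y ∈ U
      inaccessible : {I : Set i} (f : I → Carrier) (d : IsDirected poset f) →
                     ⨆ f d ∈ U → ∃[ j ] f j ∈ U

  HausdorffSeparated : Rel Carrier (lsuc (c ⊔ ℓ₂ ⊔ lsuc i))
  HausdorffSeparated x y =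
    ∃₂ λ U V → IsScottOpen U × IsScottOpen V × x ∈ U × y ∈ V ×
               (∀ z → ¬ (z ∈ U × z ∈ V))

  infix 4 _#_
  _#_ : Rel Carrier (lsuc (c ⊔ ℓ₂ ⊔ lsuc i))
  x # y = ∃[ U ] IsScottOpen U × ((x ∈ U × ¬ y ∈ U) ⊎ (y ∈ U × ¬ x ∈ U))

  ScottSpace : TopologicalSpace c ℓ₁ (c ⊔ ℓ₂ ⊔ lsuc i) (c ⊔ ℓ₂ ⊔ lsuc i)
  ScottSpace = record
    { setoid = Poset.Eq.setoid poset
    ; Open = IsScottOpen
    ; open-resp = λ { (U⊆V , V⊆U) oU → record
        { upper = λ x⊑y x∈V → U⊆V (upper oU x⊑y (V⊆U x∈V))
        ; inaccessible = λ f d s∈V →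
            let j , fj∈U = inaccessible oU f d (V⊆U s∈V) in j , U⊆V fj∈U
        } }
    ; open-cong = λ oU x≈y → upper oU (Poset.reflexive poset x≈y)
    ; open-⊤ = record
        { upper = λ _ _ → tt
        ; inaccessible = λ f d _ → IsDirected.inhabited d , tt
        }
    ; open-∩ = λ oU oV → record
        { upper = λ { x⊑y (x∈U , x∈V) → upper oU x⊑y x∈U , upper oV x⊑y x∈V }
        ; inaccessible = λ { f d (s∈U , s∈V) →
            let j , fj∈U = inaccessible oU f d s∈U
                k , fk∈V = inaccessible oV f d s∈V
                l , fj⊑fl , fk⊑fl = IsDirected.upperBound d j k
            in l , upper oU fj⊑fl fj∈U , upper oV fk⊑fl fk∈V }
        }
    ; open-⋃ = λ V oV → record
        { upper = λ { x⊑y (j , x∈V) → j , upper (oV j) x⊑y x∈V }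
        ; inaccessible = λ { f d (j , s∈V) →
            let k , fk∈V = inaccessible (oV j) f d s∈V in k , j , fk∈V }
        }
    }
    where open IsScottOpen

record ContinuousDCPO (c ℓ₁ ℓ₂ i : Level) : Set (lsuc (c ⊔ ℓ₁ ⊔ ℓ₂ ⊔ i)) where
  field
    dcpo         : DCPO c ℓ₁ ℓ₂ i
    isContinuous : DCPO.IsContinuous dcpo
  open DCPO dcpo public

  StronglyMaximal : Pred Carrier (lsuc (c ⊔ ℓ₂ ⊔ lsuc i))
  StronglyMaximal x = ∀ u v → u ≪ v → (u ≪ x) ⊎ HausdorffSeparated v x

  StronglyMaximalSpace : TopologicalSpace (lsuc (c ⊔ ℓ₂ ⊔ lsuc i)) ℓ₁
                           (c ⊔ ℓ₂ ⊔ lsuc i) (lsuc (c ⊔ ℓ₂ ⊔ lsuc i))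
  StronglyMaximalSpace = Subspace ScottSpace StronglyMaximal

------------------------------------------------------------------------
-- Rounded ideal completion

record IsAbstractBasis {B : Set} (_≺_ : Rel B 0ℓ) : Set where
  field
    trans : Transitive _≺_
    below : ∀ b → ∃[ a ] a ≺ b
    interpolate : ∀ {a₁ a₂ b} → a₁ ≺ b → a₂ ≺ b →
                  ∃[ c ] a₁ ≺ c × a₂ ≺ c × c ≺ b

module _ {B : Set} (_≺_ : Rel B 0ℓ) where

  record RoundedIdeal : Set₁ where
    field
      Member    : Pred B 0ℓ
      lower     : ∀ {a b} → a ≺ b → b ∈ Member → a ∈ Member
      inhabited : ∃[ a ] a ∈ Member
      directed  : ∀ {a b} → a ∈ Member → b ∈ Member →
                  ∃[ c ] c ∈ Member × a ≺ c × b ≺ c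

  open RoundedIdeal

  idealPoset : Poset (lsuc 0ℓ) 0ℓ 0ℓ
  idealPoset = record
    { Carrier = RoundedIdeal
    ; _≈_ = λ I J → Member I ≐ Member J
    ; _≤_ = λ I J → Member I ⊆ Member J
    ; isPartialOrder = record
      { isPreorder = record
        { isEquivalence = record
          { refl = id , id
          ; sym = λ { (p , q) → q , p }
          ; trans = λ { (p , q) (r , s) → (λ x → r (p x)) , (λ x → q (s x)) }
          }
        ; reflexive = proj₁
        ; trans = λ p q x → q (p x)
        }
      ; antisym = _,_
      }
    }

  idealDCPO : DCPO (lsuc 0ℓ) 0ℓ 0ℓ 0ℓ
  idealDCPO = record
    { poset = idealPoset
    ; ⨆ = λ {I} f d → record
      { Member = ⋃ I (λ j → Member (f j))
      ; lower = λ { a≺b (j , b∈) → j , lower (f j) a≺b b∈ }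
      ; inhabited =
          let j = IsDirected.inhabited d
              a , a∈ = inhabited (f j)
          in a , j , a∈
      ; directed = λ { (j , a∈) (k , b∈) →
          let l , fj⊑fl , fk⊑fl = IsDirected.upperBound d j k
              c , c∈ , a≺c , b≺c = directed (f l) (fj⊑fl a∈) (fk⊑fl b∈)
          in c , (l , c∈) , a≺c , b≺c }
      }
    ; ⨆-isSupremum = λ f d → record
      { isUpperBound = λ j a∈ → j , a∈
      ; isLeast = λ { u ub (j , a∈) → ub j a∈ }
      }
    }

  module _ (basis : IsAbstractBasis _≺_) where
    open IsAbstractBasis basis
    open DCPO idealDCPO using (_≪_; _⊑_; IsContinuous)

    ↓_ : B → RoundedIdeal
    ↓ b = record
      { Member = _≺ b
      ; lower = trans
      ; inhabited = below b
      ; directed = λ a₁≺b a₂≺b →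
          let c , a₁≺c , a₂≺c , c≺b = interpolate a₁≺b a₂≺b
          in c , c≺b , a₁≺c , a₂≺c
      }

    ↓-≪ : ∀ I {b} → b ∈ Member I → (↓ b) ≪ I
    ↓-≪ I b∈I f d I⊑⨆ with I⊑⨆ b∈I
    ... | j , b∈fj = j , λ a≺b → lower (f j) a≺b b∈fj

    ≪-↓ : ∀ J I → J ≪ I → ∃[ b ] b ∈ Member I × J ⊑ (↓ b)
    ≪-↓ J I J≪I =
      let (b , b∈I) , J⊑↓b = J≪I {I = ∃[ b ] b ∈ Member I} (λ p → ↓ proj₁ p)
            (record
              { inhabited = inhabited I
              ; upperBound = λ { (a , a∈) (b , b∈) →
                  let c , c∈ , a≺c , b≺c = directed I a∈ b∈
                  in (c , c∈) , (λ x≺a → trans x≺a a≺c) , (λ x≺b → trans x≺b b≺c) }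
              })
            (λ a∈I → let c , c∈ , a≺c , _ = directed I a∈I a∈I in (c , c∈) , a≺c)
      in b , b∈I , J⊑↓b

    idealDCPO-isContinuous : IsContinuous
    idealDCPO-isContinuous I =
      record
        { inhabited = let b , b∈I = inhabited I in ↓ b , ↓-≪ I b∈I
        ; upperBound = λ { (J , J≪I) (K , K≪I) →
            let a , a∈I , J⊑↓a = ≪-↓ J I J≪I
                b , b∈I , K⊑↓b = ≪-↓ K I K≪I
                c , c∈I , a≺c , b≺c = directed I a∈I b∈I
            in (↓ c , ↓-≪ I c∈I) ,
               (λ x → trans (J⊑↓a x) a≺c) , (λ x → trans (K⊑↓b x) b≺c) }
        } ,
      record
        { isUpperBound = λ { (J , J≪I) x∈J →
            let b , b∈I , J⊑↓b = ≪-↓ J I J≪I in lower I (J⊑↓b x∈J) b∈I }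
        ; isLeast = λ u ub a∈I →
            let c , c∈I , a≺c , _ = directed I a∈I a∈I
            in ub (↓ c , ↓-≪ I c∈I) a≺c
        }

    idealContinuousDCPO : ContinuousDCPO (lsuc 0ℓ) 0ℓ 0ℓ 0ℓ
    idealContinuousDCPO = record
      { dcpo = idealDCPO
      ; isContinuous = idealDCPO-isContinuous
      }

------------------------------------------------------------------------
-- Dedekind reals

-- p ∈ L is read p < x, and q ∈ U is read x < q.

record ℝ : Set₁ where
  field
    L U        : Pred ℚ 0ℓ
    bounded    : ∃₂ λ p q → p ∈ L × q ∈ U
    L-rounded  : ∀ p → p ∈ L ⇔ (∃[ r ] p < r × r ∈ L)
    U-rounded  : ∀ q → q ∈ U ⇔ (∃[ s ] s < q × s ∈ U)
    transitive : ∀ {p q} → p ∈ L → q ∈ U → p < q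
    located    : ∀ {p q} → p < q → p ∈ L ⊎ q ∈ U

open ℝ

infix 4 _≈ℝ_ _#ℝ_

_≈ℝ_ : Rel ℝ 0ℓ
x ≈ℝ y = L x ≐ L y × U x ≐ U y

_#ℝ_ : Rel ℝ 0ℓ
x #ℝ y = ∃[ p ] ((p ∈ U x × p ∈ L y) ⊎ (p ∈ U y × p ∈ L x))

BasicOpen : ℚ → ℚ → Pred ℝ 0ℓ
BasicOpen p q x = p ∈ L x × q ∈ U x

private
  L-lower : ∀ x {p q} → p ℚ.≤ q → q ∈ L x → p ∈ L x
  L-lower x {p} {q} p≤q q∈L =
    let r , q<r , r∈L = Equivalence.to (L-rounded x q) q∈L
    in Equivalence.from (L-rounded x p) (r , ℚₚ.≤-<-trans p≤q q<r , r∈L)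

  U-upper : ∀ x {p q} → p ℚ.≤ q → p ∈ U x → q ∈ U x
  U-upper x {p} {q} p≤q p∈U =
    let s , s<p , s∈U = Equivalence.to (U-rounded x p) p∈U
    in Equivalence.from (U-rounded x q) (s , ℚₚ.<-≤-trans s<p p≤q , s∈U)

  ⊔-closed : ∀ (P : Pred ℚ 0ℓ) {p q} → p ∈ P → q ∈ P → p ℚ.⊔ q ∈ P
  ⊔-closed P {p} {q} p∈ q∈ with ℚₚ.⊔-sel p q
  ... | inj₁ eq = subst P (sym eq) p∈
  ... | inj₂ eq = subst P (sym eq) q∈

  ⊓-closed : ∀ (P : Pred ℚ 0ℓ) {p q} → p ∈ P → q ∈ P → p ℚ.⊓ q ∈ P
  ⊓-closed P {p} {q} p∈ q∈ with ℚₚ.⊓-sel p q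
  ... | inj₁ eq = subst P (sym eq) p∈
  ... | inj₂ eq = subst P (sym eq) q∈

ℝ-setoid : Setoid (lsuc 0ℓ) 0ℓ
ℝ-setoid = record
  { Carrier = ℝ
  ; _≈_ = _≈ℝ_
  ; isEquivalence = record
    { refl = (id , id) , (id , id)
    ; sym = λ { ((a , b) , (c , d)) → (b , a) , (d , c) }
    ; trans = λ { ((a , b) , (c , d)) ((a′ , b′) , (c′ , d′)) →
        ((λ x → a′ (a x)) , (λ x → b (b′ x))) ,
        ((λ x → c′ (c x)) , (λ x → d (d′ x))) }
    }
  }

-- The topology generated by the basic opens; opens are Set₁-valued, as for
-- the Scott topology.

ℝ-space : TopologicalSpace (lsuc 0ℓ) 0ℓ (lsuc 0ℓ) (lsuc 0ℓ)
ℝ-space = record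
  { setoid = ℝ-setoid
  ; Open = λ V → ∀ x → x ∈ V → ∃₂ λ p q → x ∈ BasicOpen p q × BasicOpen p q ⊆ V
  ; open-resp = λ { (V⊆W , W⊆V) oV x x∈W →
      let p , q , x∈B , B⊆V = oV x (W⊆V x∈W)
      in p , q , x∈B , λ y∈B → V⊆W (B⊆V y∈B) }
  ; open-cong = λ { oV {x} ((L⊆ , _) , (U⊆ , _)) x∈V →
      let p , q , (p<x , x<q) , B⊆V = oV x x∈V
      in B⊆V (L⊆ p<x , U⊆ x<q) }
  ; open-⊤ = λ x _ →
      let p , q , x∈B = bounded x in p , q , x∈B , λ _ → tt
  ; open-∩ = λ { oV oW x (x∈V , x∈W) →
      let p , q , (p<x , x<q) , B⊆V = oV x x∈V
          r , s , (r<x , x<s) , C⊆W = oW x x∈W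
      in p ℚ.⊔ r , q ℚ.⊓ s ,
         (⊔-closed (L x) p<x r<x , ⊓-closed (U x) x<q x<s) ,
         λ { {y} (l , u) →
             B⊆V (L-lower y (ℚₚ.p≤p⊔q p r) l , U-upper y (ℚₚ.p⊓q≤p q s) u) ,
             C⊆W (L-lower y (ℚₚ.p≤q⊔p p r) l , U-upper y (ℚₚ.p⊓q≤q q s) u) } }
  ; open-⋃ = λ { V oV x (j , x∈V) →
      let p , q , x∈B , B⊆V = oV j x x∈V
      in p , q , x∈B , λ y∈B → j , B⊆V y∈B }
  }

------------------------------------------------------------------------
-- Partial Dedekind reals

ℚ×<ℚ : Set
ℚ×<ℚ = Σ[ (p , q) ∈ ℚ × ℚ ] p < q

infix 4 _≺_
_≺_ : Rel ℚ×<ℚ 0ℓ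
((p , q) , _) ≺ ((r , s) , _) = p < r × r < s × s < q

private
  between : ∀ {p q} → p < q → ∃[ m ] p < m × m < q
  between = ℚₚ.<-dense

  <-+1 : ∀ p → p < p ℚ.+ 1ℚ
  <-+1 p = subst (_< p ℚ.+ 1ℚ) (ℚₚ.+-identityʳ p)
             (ℚₚ.+-monoʳ-< p (ℚₚ.positive⁻¹ 1ℚ))

  -1-< : ∀ p → p ℚ.- 1ℚ < p
  -1-< p = subst (p ℚ.- 1ℚ <_) (ℚₚ.+-identityʳ p)
             (ℚₚ.+-monoʳ-< p (ℚₚ.negative⁻¹ (ℚ.- 1ℚ)))

≺-isAbstractBasis : IsAbstractBasis _≺_
≺-isAbstractBasis = record
  { trans = λ { (p<r , _ , s<q) (r<t , t<u , u<s) →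
      ℚₚ.<-trans p<r r<t , t<u , ℚₚ.<-trans u<s s<q }
  ; below = λ { ((p , q) , p<q) →
      ((p ℚ.- 1ℚ , q ℚ.+ 1ℚ) , ℚₚ.<-trans (-1-< p) (ℚₚ.<-trans p<q (<-+1 q))) ,
      -1-< p , p<q , <-+1 q }
  ; interpolate = λ { {(p₁ , q₁) , _} {(p₂ , q₂) , _} {(r , s) , _}
                      (p₁<r , r<s , s<q₁) (p₂<r , _ , s<q₂) →
      let m , p<m , m<r = between (⊔-closed (_< r) p₁<r p₂<r)
          n , s<n , n<q = between (⊓-closed (s <_) s<q₁ s<q₂)
          m<n = ℚₚ.<-trans m<r (ℚₚ.<-trans r<s s<n)
      in ((m , n) , m<n) ,
         (ℚₚ.≤-<-trans (ℚₚ.p≤p⊔q p₁ p₂) p<m , m<n , ℚₚ.<-≤-trans n<q (ℚₚ.p⊓q≤p q₁ q₂)) ,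
         (ℚₚ.≤-<-trans (ℚₚ.p≤q⊔p p₁ p₂) p<m , m<n , ℚₚ.<-≤-trans n<q (ℚₚ.p⊓q≤q q₁ q₂)) ,
         (m<r , r<s , s<n) }
  }

𝓡 : ContinuousDCPO (lsuc 0ℓ) 0ℓ 0ℓ 0ℓ
𝓡 = idealContinuousDCPO _≺_ ≺-isAbstractBasis

ι : ℝ → ContinuousDCPO.Carrier 𝓡
ι x = record
  { Member = λ { ((p , q) , _) → p ∈ L x × q ∈ U x }
  ; lower = λ { (p<r , _ , s<q) (r∈L , s∈U) →
      L-lower x (ℚₚ.<⇒≤ p<r) r∈L , U-upper x (ℚₚ.<⇒≤ s<q) s∈U }
  ; inhabited =
      let p , q , p∈L , q∈U = bounded x
      in ((p , q) , transitive x p∈L q∈U) , p∈L , q∈U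
  ; directed = λ { {(p , q) , _} {(p′ , q′) , _} (p∈L , q∈U) (p′∈L , q′∈U) →
      let r , p⊔p′<r , r∈L = Equivalence.to (L-rounded x _) (⊔-closed (L x) p∈L p′∈L)
          s , s<q⊓q′ , s∈U = Equivalence.to (U-rounded x _) (⊓-closed (U x) q∈U q′∈U)
          r<s = transitive x r∈L s∈U
      in ((r , s) , r<s) , (r∈L , s∈U) ,
         (ℚₚ.≤-<-trans (ℚₚ.p≤p⊔q p p′) p⊔p′<r , r<s , ℚₚ.<-≤-trans s<q⊓q′ (ℚₚ.p⊓q≤p q q′)) ,
         (ℚₚ.≤-<-trans (ℚₚ.p≤q⊔p p p′) p⊔p′<r , r<s , ℚₚ.<-≤-trans s<q⊓q′ (ℚₚ.p⊓q≤q q q′)) }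
  }

{-# OPTIONS --safe #-}
-- A Scott open neighbourhood of a rounded ideal I contains the principal ideal
-- ↓ b of some b ∈ I, so everything is controlled by rational intervals.  If
-- (p , q) ≺ (p′ , q′), locatedness places a real x inside (p , q), below p′ or
-- above q′; this gives strong maximality of ι x and the reflection of
-- apartness.  Conversely, a strongly maximal I is located at p < q: compare I
-- with a v = ↓ (m , t), where p < m < q and t lies beyond I.  If I is separated
-- from v, then some interval of I is disjoint from (m , t), and by the choice
-- of t it can only lie to the left of m.
module Submission where

open import Level using (0ℓ; Lift; lift) renaming (suc to lsuc)
open import Data.Product using (∃-syntax; _×_; _,_; proj₁; proj₂; Σ-syntax)
open import Data.Rational using (ℚ; _<_; _+_; _⊔_; _⊓_; 1ℚ)
open import Data.Rational.Properties
  using (<-dense; <-irrefl; <-trans; <-≤-trans; ≤-<-trans; _<?_; ≮⇒≥;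
         +-identityʳ; +-monoʳ-<; positive⁻¹; p≤p⊔q; p≤q⊔p; p⊓q≤p; p⊓q≤q; ⊔-sel; ⊓-sel)
open import Data.Sum using (_⊎_; inj₁; inj₂; map; swap)
open import Function.Base using (_∘_)
open import Function.Bundles using (_⇔_; mk⇔; Equivalence)
open import Relation.Binary.Bundles using (Setoid)
open import Relation.Binary.Core using (Rel)
open import Relation.Binary.PropositionalEquality using (refl; subst; sym)
open import Relation.Nullary using (¬_; yes; no; contradiction)
open import Relation.Unary using (Pred; _∈_)
open import Defs

-- Scott open sets of a rounded ideal completion.

module _ {B : Set} {_⊏_ : Rel B 0ℓ} (basis : IsAbstractBasis _⊏_) where
  open DCPO (idealDCPO _⊏_)
  open RoundedIdeal
  private
    module Basis = IsAbstractBasis basis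
    ⇓ : B → RoundedIdeal _⊏_
    ⇓ = ↓_ _⊏_ basis

  ↓-⊑ : ∀ I {b} → b ∈ Member I → ⇓ b ⊑ I
  ↓-⊑ I b∈I a⊏b = lower I a⊏b b∈I

  -- Directed suprema are unions, so a witness in the supremum already lies in one ideal of the
  -- family.
  meets-isScottOpen : (P : Pred B (lsuc 0ℓ)) →
                      IsScottOpen (λ J → ∃[ b ] b ∈ Member J × P b)
  meets-isScottOpen P = record
    { upper        = λ { J⊑K (b , b∈J , Pb) → b , J⊑K b∈J , Pb }
    ; inaccessible = λ { f d (b , (j , b∈fj) , Pb) → j , b , b∈fj , Pb }
    }

  -- `I` is the directed supremum of its principal ideals, and an open set is inaccessible by such a
  -- supremum.
  scottOpen-↓ : ∀ {U} → IsScottOpen U → ∀ I → I ∈ U → ∃[ b ] b ∈ Member I × ⇓ b ∈ U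
  scottOpen-↓ oU I I∈U =
    let (b , b∈I) , ↓b∈U = inaccessible (⇓ ∘ proj₁) directed-↓ (upper I⊑⨆ I∈U)
    in b , b∈I , ↓b∈U
    where
    open IsScottOpen oU
    directed-↓ : IsDirected poset {I = ∃[ b ] b ∈ Member I} (⇓ ∘ proj₁)
    directed-↓ = record
      { inhabited  = inhabited I
      ; upperBound = λ { (a , a∈I) (b , b∈I) →
          let c , c∈I , a⊏c , b⊏c = directed I a∈I b∈I
          in (c , c∈I) , (λ x⊏a → Basis.trans x⊏a a⊏c) , (λ x⊏b → Basis.trans x⊏b b⊏c) }
      }
    I⊑⨆ : I ⊑ ⨆ (⇓ ∘ proj₁) directed-↓
    I⊑⨆ a∈I = let c , c∈I , a⊏c , _ = directed I a∈I a∈I in (c , c∈I) , a⊏c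

open ContinuousDCPO 𝓡
  using (_≈_; _⊑_; _≪_; ScottSpace; IsScottOpen; HausdorffSeparated; StronglyMaximal; StronglyMaximalSpace)
  renaming (Carrier to PartialReal; _#_ to _#𝓡_)
open RoundedIdeal using (Member; inhabited; directed)
open ℝ

-- Cuts of a partial real, and separation by rational bounds.

left right : ℚ×<ℚ → ℚ
left  ((p , _) , _) = p
right ((_ , q) , _) = q

⟨_⟩ : ∀ {p q} → p < q → ℚ×<ℚ
⟨_⟩ {p} {q} p<q = (p , q) , p<q

⇓_ : ℚ×<ℚ → PartialReal
⇓_ = ↓_ _≺_ ≺-isAbstractBasis

unbounded : ∀ q → ∃[ t ] q < t
unbounded q = q + 1ℚ , subst (_< q + 1ℚ) (+-identityʳ q) (+-monoʳ-< q (positive⁻¹ 1ℚ))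

⊔-< : ∀ {p q r} → p < r → q < r → p ⊔ q < r
⊔-< {p} {q} p<r q<r with ⊔-sel p q
... | inj₁ eq = subst (_< _) (sym eq) p<r
... | inj₂ eq = subst (_< _) (sym eq) q<r

<-⊓ : ∀ {p q r} → r < p → r < q → r < p ⊓ q
<-⊓ {p} {q} r<p r<q with ⊓-sel p q
... | inj₁ eq = subst (_ <_) (sym eq) r<p
... | inj₂ eq = subst (_ <_) (sym eq) r<q

-- The cuts of a partial real ask for strict inequality, so that they are
-- rounded for every rounded ideal.
Lower Upper : PartialReal → Pred ℚ 0ℓ
Lower J p = ∃[ b ] b ∈ Member J × p < left b
Upper J q = ∃[ b ] b ∈ Member J × right b < q

module _ (J : PartialReal) where

  member⇒cuts : ∀ {b} → b ∈ Member J → left b ∈ Lower J × right b ∈ Upper J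
  member⇒cuts b∈J =
    let c , c∈J , (p<r , _ , s<q) , _ = directed J b∈J b∈J
    in (c , c∈J , p<r) , (c , c∈J , s<q)

  -- The two bounds come with different intervals of `J`; directedness refines both to one.
  between-cuts : ∀ {p q} → p ∈ Lower J → q ∈ Upper J →
                 ∃[ c ] c ∈ Member J × p < left c × right c < q
  between-cuts (a , a∈J , p<a) (b , b∈J , b<q) =
    let c , c∈J , (a<c , _) , (_ , _ , c<b) = directed J a∈J b∈J
    in c , c∈J , <-trans p<a a<c , <-trans c<b b<q

  cuts⇒< : ∀ {p q} → p ∈ Lower J → q ∈ Upper J → p < q
  cuts⇒< p∈L q∈U =
    let (_ , r<s) , _ , p<r , s<q = between-cuts p∈L q∈U
    in <-trans p<r (<-trans r<s s<q)

  cuts⇒member : ∀ {b} → left b ∈ Lower J → right b ∈ Upper J → b ∈ Member J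
  cuts⇒member p∈L q∈U =
    let c@(_ , r<s) , c∈J , p<r , s<q = between-cuts p∈L q∈U
    in RoundedIdeal.lower J (p<r , r<s , s<q) c∈J

  Lower-rounded : ∀ p → p ∈ Lower J ⇔ (∃[ r ] p < r × r ∈ Lower J)
  Lower-rounded p = mk⇔
    (λ { (b , b∈J , p<b) → let r , p<r , r<b = <-dense p<b in r , p<r , b , b∈J , r<b })
    (λ { (r , p<r , b , b∈J , r<b) → b , b∈J , <-trans p<r r<b })

  Upper-rounded : ∀ q → q ∈ Upper J ⇔ (∃[ s ] s < q × s ∈ Upper J)
  Upper-rounded q = mk⇔
    (λ { (b , b∈J , b<q) → let s , b<s , s<q = <-dense b<q in s , s<q , b , b∈J , b<s })
    (λ { (s , s<q , b , b∈J , b<s) → b , b∈J , <-trans b<s s<q })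

-- The cuts of `J`, seen as properties of `J` and lifted to the universe in which Scott opens take
-- values.
Above Below : ℚ → Pred PartialReal (lsuc 0ℓ)
Above p J = ∃[ b ] b ∈ Member J × Lift (lsuc 0ℓ) (p < left b)
Below q J = ∃[ b ] b ∈ Member J × Lift (lsuc 0ℓ) (right b < q)

Above-isScottOpen : ∀ p → IsScottOpen (Above p)
Above-isScottOpen p = meets-isScottOpen ≺-isAbstractBasis (λ b → Lift _ (p < left b))

Below-isScottOpen : ∀ q → IsScottOpen (Below q)
Below-isScottOpen q = meets-isScottOpen ≺-isAbstractBasis (λ b → Lift _ (right b < q))

Lower⇒Above : ∀ {J p} → p ∈ Lower J → J ∈ Above p
Lower⇒Above (b , b∈J , p<b) = b , b∈J , lift p<b

Upper⇒Below : ∀ {J q} → q ∈ Upper J → J ∈ Below q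
Upper⇒Below (b , b∈J , b<q) = b , b∈J , lift b<q

Above-Below-disjoint : ∀ p J → ¬ (J ∈ Above p × J ∈ Below p)
Above-Below-disjoint p J ((a , a∈J , lift p<a) , (b , b∈J , lift b<p)) =
  <-irrefl refl (cuts⇒< J (a , a∈J , p<a) (b , b∈J , b<p))

Upper-Lower⇒separated : ∀ {I J p} → p ∈ Upper I → p ∈ Lower J → HausdorffSeparated I J
Upper-Lower⇒separated {I} {J} {p} p∈U p∈L =
  Below p , Above p , Below-isScottOpen p , Above-isScottOpen p ,
  Upper⇒Below {I} p∈U , Lower⇒Above {J} p∈L ,
  λ { z (z∈B , z∈A) → Above-Below-disjoint p z (z∈A , z∈B) }

Lower-Upper⇒separated : ∀ {I J p} → p ∈ Lower I → p ∈ Upper J → HausdorffSeparated I J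
Lower-Upper⇒separated {I} {J} {p} p∈L p∈U =
  Above p , Below p , Above-isScottOpen p , Below-isScottOpen p ,
  Lower⇒Above {I} p∈L , Upper⇒Below {J} p∈U , Above-Below-disjoint p

-- The intersection of two overlapping intervals is again an interval; its principal ideal lies
-- above `⇓ a` and `⇓ b`, hence in both opens.
overlapping⇒¬disjoint : ∀ {U V} → IsScottOpen U → IsScottOpen V →
  ∀ {a b} → ⇓ a ∈ U → ⇓ b ∈ V → left a < right b → left b < right a →
  ¬ (∀ z → ¬ (z ∈ U × z ∈ V))
overlapping⇒¬disjoint oU oV {(p , q) , p<q} {(r , s) , r<s} a∈U b∈V p<s r<q disjoint =
  disjoint (⇓ ⟨ meet ⟩)
    ( IsScottOpen.upper oU
        (λ { (x<p , _ , q<y) →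
           <-≤-trans x<p (p≤p⊔q p r) , meet , ≤-<-trans (p⊓q≤p q s) q<y }) a∈U
    , IsScottOpen.upper oV
        (λ { (x<r , _ , s<y) →
           <-≤-trans x<r (p≤q⊔p p r) , meet , ≤-<-trans (p⊓q≤q q s) s<y }) b∈V )
  where
  meet : p ⊔ r < q ⊓ s
  meet = <-⊓ (⊔-< p<q r<q) (⊔-< p<s r<s)

-- Strong maximality of the Dedekind reals.

module _ (x : ℝ) where

  L⇒Lower : ∀ {p} → p ∈ L x → p ∈ Lower (ι x)
  L⇒Lower {p} p∈L =
    let r , p<r , r∈L = Equivalence.to (L-rounded x p) p∈L
        -- Any upper bound will do: it only completes `r` to an interval.
        _ , q , _ , q∈U = bounded x
    in ⟨ transitive x r∈L q∈U ⟩ , (r∈L , q∈U) , p<r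

  U⇒Upper : ∀ {q} → q ∈ U x → q ∈ Upper (ι x)
  U⇒Upper {q} q∈U =
    let s , s<q , s∈U = Equivalence.to (U-rounded x q) q∈U
        p , _ , p∈L , _ = bounded x
    in ⟨ transitive x p∈L s∈U ⟩ , (p∈L , s∈U) , s<q

  Lower⇒L : ∀ {p} → p ∈ Lower (ι x) → p ∈ L x
  Lower⇒L {p} (((r , _) , _) , (r∈L , _) , p<r) =
    Equivalence.from (L-rounded x p) (r , p<r , r∈L)

  Upper⇒U : ∀ {q} → q ∈ Upper (ι x) → q ∈ U x
  Upper⇒U {q} (((_ , s) , _) , (_ , s∈U) , s<q) =
    Equivalence.from (U-rounded x q) (s , s<q , s∈U)

  -- Locate `x` in each of the two gaps between the endpoints of `b` and those of `c`.
  located-≺ : ∀ {b c} → b ≺ c → b ∈ Member (ι x) ⊎ (left c ∈ U x ⊎ right c ∈ L x)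
  located-≺ (p<r , _ , s<q) with located x p<r | located x s<q
  ... | inj₂ r∈U | _        = inj₂ (inj₁ r∈U)
  ... | inj₁ _   | inj₁ s∈L = inj₂ (inj₂ s∈L)
  ... | inj₁ p∈L | inj₂ q∈U = inj₁ (p∈L , q∈U)

ι-stronglyMaximal : ∀ x → StronglyMaximal (ι x)
ι-stronglyMaximal x u v u≪v with ≪-↓ _≺_ ≺-isAbstractBasis u v u≪v
-- Refining `b` inside `v` opens a gap at each end, as locatedness requires.
... | b , b∈v , u⊑↓b with directed v b∈v b∈v
... | c , c∈v , b≺c , _ with located-≺ x {b} {c} b≺c
... | inj₁ b∈ιx = inj₁ λ f d ιx⊑⨆ →
        let j , ↓b⊑fj = ↓-≪ _≺_ ≺-isAbstractBasis (ι x) {b} b∈ιx f d ιx⊑⨆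
        in j , λ {a} a∈u → ↓b⊑fj {a} (u⊑↓b a∈u)
-- Here `left c` lies strictly between `ι x` and `v`; in the next case `right c` does.
... | inj₂ (inj₁ r∈U) =
        inj₂ (Lower-Upper⇒separated {v} {ι x} (proj₁ (member⇒cuts v c∈v)) (U⇒Upper x r∈U))
... | inj₂ (inj₂ s∈L) =
        inj₂ (Upper-Lower⇒separated {v} {ι x} (proj₂ (member⇒cuts v c∈v)) (L⇒Lower x s∈L))

-- Dedekind reals from strongly maximal elements.

≪⇒⊑ : ∀ {I J} → I ≪ J → I ⊑ J
≪⇒⊑ {I} {J} I≪J =
  let b , b∈J , I⊑↓b = ≪-↓ _≺_ ≺-isAbstractBasis I J I≪J
  in ↓-⊑ ≺-isAbstractBasis J b∈J ∘ I⊑↓b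

module _ (I : PartialReal) (maximal : StronglyMaximal I) where

  -- The case split is constructive because the order of ℚ is decidable. As `t` bounds `I`,
  -- `left c < t` always holds, so `m < right c` would complete an overlap.
  separated-left : ∀ {m t} (m<t : m < t) → t ∈ Upper I →
                   HausdorffSeparated (⇓ ⟨ m<t ⟩) I → ∀ {q} → m < q → q ∈ Upper I
  separated-left {m} m<t t∈U (V , W , oV , oW , v∈V , I∈W , disjoint) m<q
    with scottOpen-↓ ≺-isAbstractBasis oW I I∈W
  ... | c , c∈I , ↓c∈W with m <? right c
  ...   | yes m<c = contradiction disjoint
            (overlapping⇒¬disjoint oV oW v∈V ↓c∈W m<c
              (cuts⇒< I (proj₁ (member⇒cuts I c∈I)) t∈U))
  ...   | no m≮c = c , c∈I , ≤-<-trans (≮⇒≥ m≮c) m<q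

  stronglyMaximal-located : ∀ {p q} → p < q → p ∈ Lower I ⊎ q ∈ Upper I
  stronglyMaximal-located {p} {q} p<q =
    let b , b∈I = inhabited I
        m , p<m , m<q = <-dense p<q
        -- The rationals are chosen so that `(p , t″) ≺ (n , t′) ≺ (m , t)`.
        n , p<n , n<m = <-dense p<m
        -- Exceeding `right b` puts `t` in the upper cut of `I`; exceeding `q` gives `m < t`.
        t , b⊔q<t = unbounded (right b ⊔ q)
        t′ , t<t′ = unbounded t
        t″ , t′<t″ = unbounded t′
        m<t = <-trans (<-≤-trans m<q (p≤q⊔p (right b) q)) b⊔q<t
        n<t′ = <-trans n<m (<-trans m<t t<t′)
        p<t″ = <-trans p<n (<-trans n<t′ t′<t″)
        t∈U = b , b∈I , ≤-<-trans (p≤p⊔q (right b) q) b⊔q<t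
    in map {A = ⇓ ⟨ n<t′ ⟩ ≪ I}
      -- The interval `(p , t″)` belongs to `⇓ (n , t′)`, hence to `I`, and its left end is `p`.
      (λ u≪I → proj₁ (member⇒cuts I {⟨ p<t″ ⟩}
        (≪⇒⊑ {⇓ ⟨ n<t′ ⟩} {I} u≪I {⟨ p<t″ ⟩} (p<n , n<t′ , t′<t″))))
      (λ separated → separated-left m<t t∈U separated m<q)
      (maximal (⇓ ⟨ n<t′ ⟩) (⇓ ⟨ m<t ⟩)
        (↓-≪ _≺_ ≺-isAbstractBasis (⇓ ⟨ m<t ⟩) {⟨ n<t′ ⟩} (n<m , m<t , t<t′)))

  toReal : ℝ
  toReal = record
    { L          = Lower I
    ; U          = Upper I
    ; bounded    =
        let b , b∈I = inhabited I
            p∈L , q∈U = member⇒cuts I b∈I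
        in left b , right b , p∈L , q∈U
    ; L-rounded  = Lower-rounded I
    ; U-rounded  = Upper-rounded I
    ; transitive = cuts⇒< I
    ; located    = stronglyMaximal-located
    }

-- The homeomorphism.

Lower-mono : ∀ {I J} → I ⊑ J → ∀ {p} → p ∈ Lower I → p ∈ Lower J
Lower-mono I⊑J (b , b∈I , p<b) = b , I⊑J b∈I , p<b

Upper-mono : ∀ {I J} → I ⊑ J → ∀ {q} → q ∈ Upper I → q ∈ Upper J
Upper-mono I⊑J (b , b∈I , b<q) = b , I⊑J b∈I , b<q

ι-cong : ∀ {x y} → x ≈ℝ y → ι x ≈ ι y
ι-cong ((Lx⊆Ly , Ly⊆Lx) , (Ux⊆Uy , Uy⊆Ux)) =
  (λ { (p∈L , q∈U) → Lx⊆Ly p∈L , Ux⊆Uy q∈U }) ,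
  (λ { (p∈L , q∈U) → Ly⊆Lx p∈L , Uy⊆Ux q∈U })

ι-toReal : ∀ I maximal → ι (toReal I maximal) ≈ I
ι-toReal I _ = (λ { (p∈L , q∈U) → cuts⇒member I p∈L q∈U }) , member⇒cuts I

-- Cuts depend only on the ideal, and those of `ι x` are the cuts of `x` by roundedness. This serves
-- both the congruence of the inverse and one inverse law.
toReal-unique : ∀ I maximal x → I ≈ ι x → toReal I maximal ≈ℝ x
toReal-unique I _ x (I⊑ιx , ιx⊑I) =
  ((λ p∈L → Lower⇒L x (Lower-mono {I} {ι x} I⊑ιx p∈L)) ,
   (λ p∈L → Lower-mono {ι x} {I} ιx⊑I (L⇒Lower x p∈L))) ,
  ((λ q∈U → Upper⇒U x (Upper-mono {I} {ι x} I⊑ιx q∈U)) ,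
   (λ q∈U → Upper-mono {ι x} {I} ιx⊑I (U⇒Upper x q∈U)))

BasicOpen⇒⊑ι : ∀ {p q} (p<q : p < q) y → y ∈ BasicOpen p q → ⇓ ⟨ p<q ⟩ ⊑ ι y
BasicOpen⇒⊑ι p<q y y∈B {a} = ↓-⊑ ≺-isAbstractBasis (ι y) {⟨ p<q ⟩} y∈B {a}

ι-continuous : Continuous ℝ-space StronglyMaximalSpace (λ x → ι x , ι-stronglyMaximal x)
ι-continuous V (U , oU , V⊆U , U⊆V) x x∈V =
  -- An interval of `ι x` whose principal ideal is in `U` bounds the basic open sought: `ι y` lies
  -- above that ideal for each `y` in it.
  let ((p , q) , p<q) , x∈B , ↓∈U = scottOpen-↓ ≺-isAbstractBasis oU (ι x) (V⊆U x∈V)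
  in p , q , x∈B , λ {y} y∈B → U⊆V (IsScottOpen.upper oU (λ {a} → BasicOpen⇒⊑ι p<q y y∈B {a}) ↓∈U)

toReal-continuous : Continuous StronglyMaximalSpace ℝ-space (λ (I , maximal) → toReal I maximal)
toReal-continuous V oV =
  -- The Scott open extending `V`: partial reals with an interval whose basic open lies inside `V`.
  (λ J → ∃[ b ] b ∈ Member J × (∀ {y} → y ∈ BasicOpen (left b) (right b) → y ∈ V)) ,
  meets-isScottOpen ≺-isAbstractBasis _ ,
  (λ { {I , maximal} x∈V →
     let p , q , (p∈L , q∈U) , B⊆V = oV (toReal I maximal) x∈V
     in ⟨ cuts⇒< I p∈L q∈U ⟩ , cuts⇒member I p∈L q∈U , λ {y} → B⊆V {y} }) ,
  (λ { {I , maximal} (b , b∈I , B⊆V) → B⊆V {toReal I maximal} (member⇒cuts I b∈I) })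

ι-isHomeomorphism : IsHomeomorphism ℝ-space StronglyMaximalSpace
                      (λ x → ι x , ι-stronglyMaximal x)
ι-isHomeomorphism = record
  { inverse            = λ (I , maximal) → toReal I maximal
  ; isInverse          = record
    { isLeftInverse = record
      { isCongruent = record
        { cong           = λ {x} {y} → ι-cong {x} {y}
        ; isEquivalence₁ = Setoid.isEquivalence ℝ-setoid
        ; isEquivalence₂ = Setoid.isEquivalence
                             (TopologicalSpace.setoid StronglyMaximalSpace)
        }
      ; from-cong   = λ { {I , i} {J , j} I≈J → toReal-unique I i (toReal J j)
                          (Eq.trans {I} {J} {ι (toReal J j)} I≈J
                            (Eq.sym {ι (toReal J j)} {J} (ι-toReal J j))) }
      ; inverseˡ    = λ { {I , i} {x} x≈ → Eq.trans {ι x} {ι (toReal I i)} {I}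
                          (ι-cong {x} {toReal I i} x≈) (ι-toReal I i) }
      }
    ; inverseʳ      = λ { {x} {I , i} → λ I≈ιx → toReal-unique I i x I≈ιx }
    }
  ; continuous         = ι-continuous
  ; inverse-continuous = toReal-continuous
  }
  where module Eq = Setoid (TopologicalSpace.setoid ScottSpace)

-- Apartness.

separated-∈-∉ : ∀ x y {p} → p ∈ U x → p ∈ L y → ι y ∈ Above p × ¬ ι x ∈ Above p
separated-∈-∉ x y {p} p∈U p∈L =
  Lower⇒Above {ι y} (L⇒Lower y p∈L) ,
  λ x∈A → Above-Below-disjoint p (ι x) (x∈A , Upper⇒Below {ι x} (U⇒Upper x p∈U))

ι-preserves-# : ∀ x y → x #ℝ y → ι x #𝓡 ι y
-- The `swap` is due to `x < p < y` putting `ι y`, not `ι x`, in `Above p`.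
ι-preserves-# x y (p , x<p<y⊎y<p<x) = Above p , Above-isScottOpen p , swap (map
  (λ (x<p , p<y) → separated-∈-∉ x y x<p p<y)
  (λ (y<p , p<x) → separated-∈-∉ y x y<p p<x)
  x<p<y⊎y<p<x)

#ℝ-sym : ∀ x y → x #ℝ y → y #ℝ x
#ℝ-sym _ _ (p , x<p<y⊎y<p<x) = p , swap x<p<y⊎y<p<x

-- Locatedness of `y` turns the negative hypothesis into a positive conclusion: `y` cannot lie
-- within `b`, since `⇓ b` is in `V`, so it lies beyond an endpoint of the finer `c`, which strictly
-- bounds `x`.
scottOpen-∈-∉⇒#ℝ : ∀ {V} → IsScottOpen V → ∀ x y → ι x ∈ V → ¬ ι y ∈ V → x #ℝ y
scottOpen-∈-∉⇒#ℝ oV x y x∈V y∉V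
  with scottOpen-↓ ≺-isAbstractBasis oV (ι x) x∈V
... | b , b∈ιx , ↓b∈V with directed (ι x) {b} {b} b∈ιx b∈ιx
... | c , (r∈Lx , s∈Ux) , b≺c , _ with located-≺ y {b} {c} b≺c
... | inj₁ b∈ιy        = contradiction
        (IsScottOpen.upper oV (λ {a} → BasicOpen⇒⊑ι (proj₂ b) y b∈ιy {a}) ↓b∈V) y∉V
... | inj₂ (inj₁ r∈Uy) = left c , inj₂ (r∈Uy , r∈Lx)
... | inj₂ (inj₂ s∈Ly) = right c , inj₁ (s∈Ux , s∈Ly)

ι-reflects-# : ∀ x y → ι x #𝓡 ι y → x #ℝ y
ι-reflects-# x y (V , oV , inj₁ (x∈V , y∉V)) = scottOpen-∈-∉⇒#ℝ oV x y x∈V y∉V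
ι-reflects-# x y (V , oV , inj₂ (y∈V , x∉V)) =
  #ℝ-sym y x (scottOpen-∈-∉⇒#ℝ oV y x y∈V x∉V)

theorem7p18 : (Σ[ stronglyMaximal ∈ (∀ x → ContinuousDCPO.StronglyMaximal 𝓡 (ι x)) ]
    IsHomeomorphism ℝ-space (ContinuousDCPO.StronglyMaximalSpace 𝓡)
    (λ x → ι x , stronglyMaximal x))
    × (∀ x y → (x #ℝ y) ⇔ ContinuousDCPO._#_ 𝓡 (ι x) (ι y))
theorem7p18 =
  (ι-stronglyMaximal , ι-isHomeomorphism) ,
  λ x y → mk⇔ (ι-preserves-# x y) (ι-reflects-# x y)
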